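{- For $n\ge 2$ and $m\ge 4$, $sn(C_{2n}(K_m^-))=(m-3)n+1$.
   Context: Graphs are finite, undirected and simple. $C_{2n}(K_m)$ is the graph obtained from a $2n$-cycle $C_{2n}=x_1x_2\cdots x_{2n}x_1$ and $n$ pairwise disjoint copies $K^1,\dots,K^n$ of the complete graph $K_m$ by identifying, for each $1\le i\le n$, the edge $x_{2i-1}x_{2i}$ of the cycle with an edge of $K^i$. $C_{2n}(K_m^-)$ is the graph obtained from $C_{2n}(K_m)$ by removing the $n$ edges $x_{2i-1}x_{2i}$, $1\le i\le n$. Let $G=(V,E)$ be a connected graph with chromatic number $\chi(G)=k\ge 2$. For $S\subset V$, a partial coloring on $G[S]$ is a proper coloring $\mathscr C_0$ of the induced subgraph $G[S]$ with colors from $\{1,\dots,k\}$ (not all colors need be used). It is a Sudoku coloring of $G$ if there is exactly one proper $k$-coloring $V\to\{1,\dots,k\}$ of $G$ whose restriction to $S$ is $\mathscr C_0$. The Sudoku number $sn(G)$ is the smallest $|S|$ such that $G[S]$ admits a Sudoku coloring of $G$. -}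

module Defs where

open import Data.Fin using (Fin; toℕ)
open import Data.Fin.Base using (remQuot)
open import Data.Fin.Subset using (Subset; _∈_; ∣_∣)
open import Data.Nat using (ℕ; suc; _≤_; _*_)
open import Data.Nat.Properties using (0≢1+n)
open import Data.Product using (Σ; ∃-syntax; ∃!; _×_; _,_; proj₁; proj₂)
open import Data.Sum using (_⊎_; inj₁; inj₂; swap)
open import Function using (_∘_)
open import Relation.Binary.Construct.Closure.ReflexiveTransitive using (Star)
open import Relation.Binary.Definitions using (Symmetric)
open import Relation.Binary.PropositionalEquality
  using (_≡_; _≢_; _≗_; refl; sym; trans)
open import Relation.Nullary using (¬_)

record Graph (V : Set) : Set₁ where
  field
    Adj    : V → V → Set
    symm   : Symmetric Adj
    irrefl : ∀ {v} → ¬ Adj v v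

open Graph public

-- Relabelling of the vertices along f; only used for a bijection f (to give
-- a graph the vertex set Fin N) and for the inclusion of a vertex subset.
pullback : ∀ {V W : Set} → (W → V) → Graph V → Graph W
pullback f G = record
  { Adj    = λ u v → Adj G (f u) (f v)
  ; symm   = symm G
  ; irrefl = irrefl G
  }

deleteEdges : ∀ {V : Set} → Graph V → (R : V → V → Set) → Symmetric R → Graph V
deleteEdges G R R-sym = record
  { Adj    = λ u v → Adj G u v × ¬ R u v
  ; symm   = λ (e , ¬r) → symm G e , (¬r ∘ R-sym)
  ; irrefl = λ (e , _) → irrefl G e
  }

_[_] : ∀ {N} → Graph (Fin N) → (S : Subset N) → Graph (Σ (Fin N) (_∈ S))
G [ S ] = pullback proj₁ G

Connected : ∀ {V : Set} → Graph V → Set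
Connected G = ∀ u v → Star (Adj G) u v

Proper : ∀ {V : Set} {k : ℕ} → Graph V → (V → Fin k) → Set
Proper G c = ∀ {u v} → Adj G u v → c u ≢ c v

Colorable : ∀ {V : Set} → Graph V → ℕ → Set
Colorable {V} G k = Σ (V → Fin k) (Proper G)

HasChromaticNumber : ∀ {V : Set} → Graph V → ℕ → Set
HasChromaticNumber G k = Colorable G k × (∀ j → Colorable G j → k ≤ j)

-- In the two definitions below, k is meant to be the chromatic number of G.
IsSudokuColoring : ∀ {N k} (G : Graph (Fin N)) (S : Subset N) →
                   (Σ (Fin N) (_∈ S) → Fin k) → Set
IsSudokuColoring {N} {k} G S c₀ =
  Proper (G [ S ]) c₀ ×
  ∃! _≗_ (λ (c : Fin N → Fin k) →
            Proper G c × (∀ v (v∈S : v ∈ S) → c v ≡ c₀ (v , v∈S)))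

AdmitsSudokuColoring : ∀ {N} → Graph (Fin N) → ℕ → Subset N → Set
AdmitsSudokuColoring {N} G k S =
  Σ (Σ (Fin N) (_∈ S) → Fin k) (IsSudokuColoring G S)

-- sn(G) as a relation: sn(G) is defined (G is connected with chromatic
-- number k ≥ 2) and equal to s.
record HasSudokuNumber {N : ℕ} (G : Graph (Fin N)) (s : ℕ) : Set where
  field
    connected : Connected G
    k         : ℕ
    chromatic : HasChromaticNumber G k
    k≥2       : 2 ≤ k
    attained  : ∃[ S ] AdmitsSudokuColoring G k S × ∣ S ∣ ≡ s
    minimal   : ∀ S → AdmitsSudokuColoring G k S → s ≤ ∣ S ∣

CyclicSuc : ∀ {n} → Fin n → Fin n → Set
CyclicSuc {n} i j =
  (suc (toℕ i) ≡ toℕ j) ⊎ (suc (toℕ i) ≡ n × toℕ j ≡ 0)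

-- Vertex (i , a) is the a-th vertex of the i-th copy of K_m (copies counted
-- from 0).  Every cycle vertex lies in exactly one copy:
--   x_{2i+1} = (i , 0)   and   x_{2i+2} = (i , 1).
-- The cycle edge x_{2i+1} x_{2i+2} is an edge of the i-th copy (identified
-- with it), so only the edges x_{2i+2} x_{2i+3} have to be added to the copies.
module _ {n m : ℕ} where

  data CopyEdge : Fin n × Fin m → Fin n × Fin m → Set where
    copy : ∀ {i a b} → a ≢ b → CopyEdge (i , a) (i , b)

  data LinkEdge : Fin n × Fin m → Fin n × Fin m → Set where
    link : ∀ {i j a b} → CyclicSuc i j → toℕ a ≡ 1 → toℕ b ≡ 0 →
           LinkEdge (i , a) (j , b)

  -- The edges x_{2i+1} x_{2i+2}.
  data MatchingEdge : Fin n × Fin m → Fin n × Fin m → Set where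
    up   : ∀ {i a b} → toℕ a ≡ 0 → toℕ b ≡ 1 → MatchingEdge (i , a) (i , b)
    down : ∀ {i a b} → toℕ a ≡ 1 → toℕ b ≡ 0 → MatchingEdge (i , a) (i , b)

  MatchingEdge-sym : Symmetric MatchingEdge
  MatchingEdge-sym (up a≡0 b≡1)   = down b≡1 a≡0
  MatchingEdge-sym (down a≡1 b≡0) = up b≡0 a≡1

C₂ₙ⟨K⟩ : ∀ n m → Graph (Fin n × Fin m)
C₂ₙ⟨K⟩ n m = record { Adj = E ; symm = E-sym ; irrefl = E-irrefl }
  where
  E : Fin n × Fin m → Fin n × Fin m → Set
  E u v = CopyEdge u v ⊎ (LinkEdge u v ⊎ LinkEdge v u)

  E-sym : Symmetric E
  E-sym (inj₁ (copy a≢b)) = inj₁ (copy (a≢b ∘ sym))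
  E-sym (inj₂ e)          = inj₂ (swap e)

  link-irrefl : ∀ {v} → ¬ LinkEdge v v
  link-irrefl (link _ a≡1 a≡0) = 0≢1+n (trans (sym a≡0) a≡1)

  E-irrefl : ∀ {v} → ¬ E v v
  E-irrefl (inj₁ (copy a≢a))  = a≢a refl
  E-irrefl (inj₂ (inj₁ e))    = link-irrefl e
  E-irrefl (inj₂ (inj₂ e))    = link-irrefl e

C₂ₙ⟨K⁻⟩ : ∀ n m → Graph (Fin (n * m))
C₂ₙ⟨K⁻⟩ n m =
  pullback (remQuot {n} m) (deleteEdges (C₂ₙ⟨K⟩ n m) MatchingEdge MatchingEdge-sym)

{-# OPTIONS --safe #-}
-- Contracting each copy to the common colour t i of its two ends (a proper
-- k-colouring with k = m − 1 must colour them alike) leaves a proper colouring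
-- t of a cycle.
--
-- Lower bound: if two of the m − 2 inner vertices of a copy carry no clue, their
-- colours can be exchanged, so every copy has at least m − 3 clues.  If every
-- copy has exactly m − 3, its ends and one inner vertex, of colour s i, are
-- without clue, and s i and t i may be exchanged in any set of copies for which
-- the new cycle colouring is proper.  Such a nonempty set exists since a cycle
-- is not uniquely list colourable from lists {t i , s i} of size 2.
--
-- Upper bound: leave one inner vertex without clue in each copy and give it the
-- colour of the ends of the previous copy.  A single further clue at one end
-- then forces the colours of all ends one after the other around the cycle.
module Submission where

open import Defs
open import Data.Bool using (Bool; true; false; if_then_else_)
open import Data.Fin using (Fin; zero; suc; toℕ; fromℕ; inject₁; punchIn; combine; remQuot; _≟_)
open import Data.Fin.Induction using (<-weakInduction)
open import Data.Fin.Patterns using (0F; 1F; 2F)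
open import Data.Fin.Permutation using (Permutation′; _⟨$⟩ʳ_; _⟨$⟩ˡ_; _∘ₚ_; inverseʳ)
import Data.Fin.Permutation as P
open import Data.Fin.Permutation.Components using (transpose; transpose-inverse)
open import Data.Fin.Properties
  using (any?; ∀-cons; suc-injective; toℕ-injective; toℕ-fromℕ; toℕ-inject₁; <⇒≢;
         combine-remQuot; remQuot-combine; punchIn-injective; pigeonhole; injective⇒≤)
open import Data.Fin.Relation.Unary.Top
  using (view; view-fromℕ; view-inject₁; ‵fromℕ; ‵inject₁)
open import Data.Fin.Subset using (Subset; ∣_∣; ⊤)
open import Data.Fin.Subset.Properties using (∣⊤∣≡n)
open import Data.Nat using (ℕ; zero; suc; _+_; _*_; _∸_; _≤_; _≤?_; z≤n; s≤s)
import Data.Nat.Properties as ℕ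
open import Data.Product using (∃; ∃-syntax; _×_; _,_; proj₁; proj₂; uncurry)
open import Data.Sum using (_⊎_; inj₁; inj₂)
open import Data.Vec using (Vec; []; _∷_; _++_; lookup; concat; group; replicate)
open import Data.Vec.Functional using () renaming (_∷_ to _∷ᶠ_)
open import Data.Vec.Properties using ([]=⇒lookup; lookup⇒[]=; lookup-concat; lookup-replicate)
open import Function using (_∘_; Injection)
open import Function.Properties.Inverse using (↔⇒↣)
open import Relation.Binary.Construct.Closure.ReflexiveTransitive
  using (Star; ε; _◅_; _◅◅_; gmap; reverse)
open import Relation.Binary.PropositionalEquality
  using (_≡_; _≢_; _≗_; refl; sym; trans; cong; subst₂; module ≡-Reasoning)
open import Relation.Nullary using (¬_; ¬?; yes; no; contradiction)
open import Relation.Nullary.Decidable using (dec-true; dec-false; decidable-stable)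

private variable
  k l m n q : ℕ
  I : Set

-- Cyclic predecessor and successor.

prev : Fin (suc l) → Fin (suc l)
prev zero    = fromℕ _
prev (suc i) = inject₁ i

next : Fin (suc l) → Fin (suc l)
next i with view i
... | ‵fromℕ     = zero
... | ‵inject₁ j = suc j

next-prev : (i : Fin (suc l)) → next (prev i) ≡ i
next-prev {l} zero  rewrite view-fromℕ l   = refl
next-prev (suc i)   rewrite view-inject₁ i = refl

prev-next : (i : Fin (suc l)) → prev (next i) ≡ i
prev-next i with view i
... | ‵fromℕ     = refl
... | ‵inject₁ j = refl

cyclicSuc-prev : (i : Fin (suc l)) → CyclicSuc (prev i) i
cyclicSuc-prev zero    = inj₂ (cong suc (toℕ-fromℕ _) , refl)
cyclicSuc-prev (suc i) = inj₁ (cong suc (toℕ-inject₁ i))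

cyclicSuc⇒prev : {i j : Fin (suc l)} → CyclicSuc i j → i ≡ prev j
cyclicSuc⇒prev {j = suc j} (inj₁ e) =
  toℕ-injective (trans (ℕ.suc-injective e) (sym (toℕ-inject₁ j)))
cyclicSuc⇒prev {j = zero} (inj₂ (e , _)) =
  toℕ-injective (trans (ℕ.suc-injective e) (sym (toℕ-fromℕ _)))

prev-irrefl : (i : Fin (suc (suc l))) → prev i ≢ i
prev-irrefl (suc i) e =
  ℕ.1+n≢n (trans (cong toℕ (sym e)) (toℕ-inject₁ i))

-- Recolouring a cycle from lists of size two.

ProperPath ProperCycle : (Fin (suc l) → Fin k) → Set
ProperPath  t = ∀ i → t (inject₁ i) ≢ t (suc i)
-- Since `prev` computes on `zero` and `suc`, this unfolds to the seam from `fromℕ l` to `zero`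
-- together with `ProperPath t`; `∀-cons` joins the two.
ProperCycle t = ∀ i → t (prev i) ≢ t i

select : (I → Bool) → (t s : I → Fin k) → I → Fin k
select F t s i = if F i then s i else t i

-- Switching the first vertex is harmless unless its new colour is the old colour of the second,
-- which must then be switched too, and so on. Inside the switched segment every link is proper: the
-- new colour on its left is the old colour on its right.
switch-from-start : (t s : Fin (suc l) → Fin k) → ProperPath t → (∀ i → t i ≢ s i) →
  (∀ i → s (inject₁ i) ≡ t (suc i)) ⊎
  ∃ λ F → F zero ≡ true × F (fromℕ l) ≡ false × ProperPath (select F t s)
switch-from-start {zero}  t s t-proper t≢s = inj₁ λ ()
switch-from-start {suc l} t s t-proper t≢s with s zero ≟ t (suc zero)
... | no s₀≢t₁ = inj₂ (true ∷ᶠ (λ _ → false) , refl , refl ,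
                       ∀-cons s₀≢t₁ (t-proper ∘ suc))
... | yes s₀≡t₁ with switch-from-start (t ∘ suc) (s ∘ suc) (t-proper ∘ suc) (t≢s ∘ suc)
...   | inj₁ forced = inj₁ (∀-cons s₀≡t₁ forced)
...   | inj₂ (F , first , last , proper) = inj₂ (true ∷ᶠ F , refl , last , ∀-cons start proper)
  where
  start : s zero ≢ select F (t ∘ suc) (s ∘ suc) zero
  start rewrite first | s₀≡t₁ = t≢s (suc zero)

-- Mirror image of `switch-from-start`: the segment grows backwards from the last vertex, so the
-- recursion settles the tail before it looks at the first link.
switch-to-end : (t s : Fin (suc l) → Fin k) → ProperPath t → (∀ i → t i ≢ s i) →
  (∀ i → s (suc i) ≡ t (inject₁ i)) ⊎
  ∃ λ F → F zero ≡ false × F (fromℕ l) ≡ true × ProperPath (select F t s)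
switch-to-end {zero}  t s t-proper t≢s = inj₁ λ ()
switch-to-end {suc l} t s t-proper t≢s
  with switch-to-end (t ∘ suc) (s ∘ suc) (t-proper ∘ suc) (t≢s ∘ suc)
... | inj₂ (F , first , last , proper) = inj₂ (false ∷ᶠ F , refl , last , ∀-cons start proper)
  where
  start : t zero ≢ select F (t ∘ suc) (s ∘ suc) zero
  start rewrite first = t-proper zero
... | inj₁ forced with s (suc zero) ≟ t zero
...   | yes s₁≡t₀ = inj₁ (∀-cons s₁≡t₀ forced)
...   | no  s₁≢t₀ = inj₂ (false ∷ᶠ (λ _ → true) , refl , refl , ∀-cons (s₁≢t₀ ∘ sym) proper)
  where
  proper : ProperPath (s ∘ suc)
  proper i e = t≢s (suc (inject₁ i)) (sym (trans e (forced i)))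

-- Together the two forcing relations say that each step exchanges the entries of the pair
-- `(t i , s i)`.
two-colours : (t s : Fin (suc l) → Fin k) →
  (∀ i → s (inject₁ i) ≡ t (suc i)) → (∀ i → s (suc i) ≡ t (inject₁ i)) →
  ∀ i → (t i ≡ t zero × s i ≡ s zero) ⊎ (t i ≡ s zero × s i ≡ t zero)
two-colours t s forward backward = <-weakInduction _ (inj₁ (refl , refl)) step
  where
  step : ∀ i →
    (t (inject₁ i) ≡ t zero × s (inject₁ i) ≡ s zero) ⊎
    (t (inject₁ i) ≡ s zero × s (inject₁ i) ≡ t zero) →
    (t (suc i) ≡ t zero × s (suc i) ≡ s zero) ⊎
    (t (suc i) ≡ s zero × s (suc i) ≡ t zero)
  step i (inj₁ (p , q)) = inj₂ (trans (sym (forward i)) q , trans (backward i) p)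
  step i (inj₂ (p , q)) = inj₁ (trans (sym (forward i)) q , trans (backward i) p)

Switchable : (t s : Fin (suc l) → Fin k) → Set
Switchable t s = ∃ λ F → ∃ (λ i → F i ≡ true) × ProperCycle (select F t s)

-- Switch a minimal initial segment of the path cut open between fromℕ l and zero.
-- If that is the whole path and the seam s (fromℕ l) ≡ s zero is in conflict,
-- switch a minimal final segment instead.  If both directions force everything,
-- t and s alternate between two colours, and properness excludes that conflict.
switch-cut : (t s : Fin (suc l) → Fin k) → ProperCycle t → (∀ i → t i ≢ s i) →
  s zero ≢ t (fromℕ l) → Switchable t s
switch-cut {l} t s t-proper t≢s cut with switch-from-start t s (t-proper ∘ suc) t≢s
... | inj₂ (F , first , last , proper) = F , (zero , first) , ∀-cons wrap proper
  where
  wrap : select F t s (fromℕ l) ≢ select F t s zero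
  wrap rewrite first | last = cut ∘ sym
... | inj₁ forward with s (fromℕ l) ≟ s zero
...   | no sₗ≢s₀ = (λ _ → true) , (zero , refl) , ∀-cons sₗ≢s₀ proper
  where
  proper : ProperPath s
  proper i e = t≢s (suc i) (trans (sym (forward i)) e)
...   | yes sₗ≡s₀ with switch-to-end t s (t-proper ∘ suc) t≢s
...     | inj₂ (F , first , last , proper) = F , (fromℕ l , last) , ∀-cons wrap proper
  where
  wrap : select F t s (fromℕ l) ≢ select F t s zero
  wrap rewrite first | last | sₗ≡s₀ = t≢s zero ∘ sym
...     | inj₁ backward with two-colours t s forward backward (fromℕ l)
...       | inj₁ (tₗ≡t₀ , _) = contradiction tₗ≡t₀ (t-proper zero)
...       | inj₂ (_ , sₗ≡t₀) = contradiction (trans (sym sₗ≡t₀) sₗ≡s₀) (t≢s zero)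

-- Rotating the cycle by one moves the cut from `suc r` to `inject₁ r`, down to `switch-cut` at
-- `zero`; the switching set found there is carried back along `prev`.
switch-rotated : (r : Fin (suc l)) (t s : Fin (suc l) → Fin k) →
  ProperCycle t → (∀ i → t i ≢ s i) → s r ≢ t (prev r) → Switchable t s
switch-rotated {l} {k} = <-weakInduction
  (λ r → (t s : Fin (suc l) → Fin k) →
         ProperCycle t → (∀ i → t i ≢ s i) → s r ≢ t (prev r) → Switchable t s)
  switch-cut step
  where
  step : ∀ r → _ → _
  step r ih t s t-proper t≢s cut
    with ih (t ∘ next) (s ∘ next) rotated-proper (t≢s ∘ next) rotated-cut
    where
    rotated-proper : ProperCycle (t ∘ next)
    rotated-proper i e = t-proper (next i)
      (trans (cong t (trans (prev-next i) (sym (next-prev i)))) e)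
    -- Here `prev (suc r)` stands for the definitionally equal `inject₁ r`, so that `next-prev` can
    -- rewrite it.
    rotated-cut : s (next (prev (suc r))) ≢ t (next (prev (prev (suc r))))
    rotated-cut rewrite next-prev (suc r) | next-prev (prev (suc r)) = cut
  ... | F , (i , Fi) , proper =
    F ∘ prev , (next i , trans (cong F (prev-next i)) Fi) , λ j e →
      proper (prev j) (trans (unrotate (prev j)) (trans e (sym (unrotate j))))
    where
    unrotate : ∀ j → select F (t ∘ next) (s ∘ next) (prev j) ≡ select (F ∘ prev) t s j
    unrotate j rewrite next-prev j = refl

-- If s i ≡ t (prev i) everywhere, switching all vertices just rotates t.
cycle-not-uniquely-2-list-colourable : (t s : Fin (suc l) → Fin k) →
  ProperCycle t → (∀ i → t i ≢ s i) → Switchable t s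
cycle-not-uniquely-2-list-colourable {l} t s t-proper t≢s
  with any? (λ r → ¬? (s r ≟ t (prev r)))
... | yes (r , cut) = switch-rotated r t s t-proper t≢s cut
... | no  no-cut    = (λ _ → true) , (zero , refl) , λ i e →
  t≢s (prev i) (trans (sym (decidable-stable (s i ≟ t (prev i)) (no-cut ∘ (i ,_)))) (sym e))

-- The graph with vertices as pairs of copy and position.

K⁻ : ∀ n m → Graph (Fin n × Fin m)
K⁻ n m = deleteEdges (C₂ₙ⟨K⟩ n m) MatchingEdge MatchingEdge-sym

matching-in-copy : {u v : Fin n × Fin m} → MatchingEdge u v → proj₁ u ≡ proj₁ v
matching-in-copy (up _ _)   = refl
matching-in-copy (down _ _) = refl

adj-inner : (i : Fin n) {a : Fin (2 + m)} {b : Fin m} → a ≢ suc (suc b) →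
  Adj (K⁻ n (2 + m)) (i , a) (i , suc (suc b))
adj-inner i a≢b = inj₁ (copy a≢b) , λ { (up _ ()) ; (down _ ()) }

-- With at least two copies a link joins different copies, so it is not among the deleted edges.
adj-link : (i : Fin (2 + l)) → Adj (K⁻ (2 + l) (2 + m)) (prev i , 1F) (i , 0F)
adj-link i = inj₂ (inj₁ (link (cyclicSuc-prev i) refl refl)) ,
             prev-irrefl i ∘ matching-in-copy

-- Up to symmetry these are all the edges: the only pair of positions in a copy without an inner
-- vertex is the pair of ends, whose edge is deleted.
K⁻-proper : (d : Fin (suc l) × Fin (2 + m) → Fin k) →
  (∀ i a b → a ≢ suc (suc b) → d (i , a) ≢ d (i , suc (suc b))) →
  (∀ i → d (prev i , 1F) ≢ d (i , 0F)) →
  Proper (K⁻ (suc l) (2 + m)) d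
K⁻-proper d inner linked (inj₁ (copy {i} {a} {b} a≢b) , ¬matching) =
  in-copy a b a≢b ¬matching
  where
  in-copy : ∀ a b → a ≢ b → ¬ MatchingEdge (i , a) (i , b) → d (i , a) ≢ d (i , b)
  in-copy a (suc (suc b)) a≢b _ = inner i a b a≢b
  in-copy (suc (suc a)) b a≢b _ = inner i b a (a≢b ∘ sym) ∘ sym
  in-copy 0F 0F a≢b _ = contradiction refl a≢b
  in-copy 1F 1F a≢b _ = contradiction refl a≢b
  in-copy 0F 1F _ ¬matching = contradiction (up refl refl) ¬matching
  in-copy 1F 0F _ ¬matching = contradiction (down refl refl) ¬matching
K⁻-proper {l} {m} d inner linked (inj₂ e , _) = across e
  where
  link-proper : ∀ {u v} → LinkEdge {suc l} {2 + m} u v → d u ≢ d v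
  link-proper (link {j = j} {a = 1F} {b = 0F} i→j refl refl)
    rewrite cyclicSuc⇒prev i→j = linked j
  across : ∀ {u v} → LinkEdge {suc l} {2 + m} u v ⊎ LinkEdge v u → d u ≢ d v
  across (inj₁ e) = link-proper e
  across (inj₂ e) = link-proper e ∘ sym

adj-combine : {u v : Fin n × Fin m} → Adj (K⁻ n m) u v →
  Adj (C₂ₙ⟨K⁻⟩ n m) (uncurry combine u) (uncurry combine v)
adj-combine {n} {m} {i , a} {j , b} =
  subst₂ (Adj (K⁻ n m)) (sym (remQuot-combine i a)) (sym (remQuot-combine j b))

proper-on-pairs : {c : Fin (n * m) → Fin k} →
  Proper (C₂ₙ⟨K⁻⟩ n m) c → Proper (K⁻ n m) (c ∘ uncurry combine)
proper-on-pairs c-proper = c-proper ∘ adj-combine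

-- Sudoku colourings as clue sets determining a colouring.

Agree : Vec (Subset m) n → (d d′ : Fin n × Fin m → Fin k) → Set
Agree B d d′ = ∀ i a → lookup (lookup B i) a ≡ true → d (i , a) ≡ d′ (i , a)

-- The clue values are taken from `d` itself, so an extension exists and only uniqueness is left;
-- `B` lists the clue positions copy by copy.
Determines : Vec (Subset m) n → (Fin n × Fin m → Fin k) → Set
Determines {m} {n} B d = ∀ d′ → Proper (K⁻ n m) d′ → Agree B d d′ → d ≗ d′

sudoku⇒determines : ∀ {S} → AdmitsSudokuColoring (C₂ₙ⟨K⁻⟩ n m) k S →
  ∃[ B ] S ≡ concat B × ∃[ d ] Proper {k = k} (K⁻ n m) d × Determines B d
sudoku⇒determines {n} {m} {S = S} (c₀ , _ , c , (c-proper , c-extends) , c-unique)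
  with group n m S
... | B , refl = B , refl , c ∘ uncurry combine , proper-on-pairs c-proper , determines
  where
  determines : Determines B (c ∘ uncurry combine)
  determines d d-proper agree (i , a) =
    trans (c-unique {d ∘ remQuot m} (d-proper , extends) (combine i a))
          (cong d (remQuot-combine i a))
    where
    extends : ∀ v v∈S → d (remQuot m v) ≡ c₀ (v , v∈S)
    extends v v∈S with i , a ← remQuot {n} m v in eq = trans (sym (agree i a a∈B))
      (trans (cong c v≡) (c-extends v v∈S))
      where
      v≡ : combine i a ≡ v
      v≡ = trans (cong (uncurry combine) (sym eq)) (combine-remQuot {n} m v)
      a∈B : lookup (lookup B i) a ≡ true
      a∈B = trans (sym (lookup-concat B i a))
                  (trans (cong (lookup (concat B)) v≡) ([]=⇒lookup v∈S))

determines⇒sudoku : (B : Vec (Subset m) n) (d : Fin n × Fin m → Fin k) →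
  Proper (K⁻ n m) d → Determines B d → AdmitsSudokuColoring (C₂ₙ⟨K⁻⟩ n m) k (concat B)
determines⇒sudoku {m} {n} B d d-proper determines =
  d ∘ remQuot m ∘ proj₁ , d-proper , d ∘ remQuot m , (d-proper , λ _ _ → refl) , unique
  where
  unique : ∀ {c} → Proper (C₂ₙ⟨K⁻⟩ n m) c × (∀ v v∈S → c v ≡ d (remQuot m v)) →
           d ∘ remQuot m ≗ c
  unique {c} (c-proper , c-extends) v =
    trans (determines (c ∘ uncurry combine) (proper-on-pairs c-proper) agree (remQuot m v))
          (cong c (combine-remQuot {n} m v))
    where
    agree : Agree B d (c ∘ uncurry combine)
    agree i a a∈B = sym (trans
      (c-extends (combine i a) (lookup⇒[]= _ (concat B) (trans (lookup-concat B i a) a∈B)))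
      (cong d (remQuot-combine i a)))

-- Recolouring by permuting the colours of each copy.

ends-alike : (d : Fin n × Fin (3 + q) → Fin (2 + q)) → Proper (K⁻ n (3 + q)) d →
  ∀ i → d (i , 0F) ≡ d (i , 1F)
ends-alike d d-proper i with pigeonhole ℕ.≤-refl (d ∘ (i ,_))
-- A repeated colour at an inner vertex would violate an edge; the remaining pair with `x < y` is
-- that of the ends.
... | x , suc (suc y) , x<y , eq = contradiction eq (d-proper (adj-inner i (<⇒≢ x<y)))
... | 0F , 1F , _ , eq = eq
... | suc _ , 1F , s≤s () , _
... | _ , 0F , () , _

⟨$⟩ʳ-injective : (π : Permutation′ k) {x y : Fin k} → π ⟨$⟩ʳ x ≡ π ⟨$⟩ʳ y → x ≡ y
⟨$⟩ʳ-injective π = Injection.injective (↔⇒↣ π)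

transpose-left : (i j : Fin k) → transpose i j i ≡ j
transpose-left i j rewrite dec-true (i ≟ i) refl = refl

transpose-fixes : {i j x : Fin k} → x ≢ i → x ≢ j → transpose i j x ≡ x
transpose-fixes {i = i} {j} {x} x≢i x≢j
  rewrite dec-false (x ≟ i) x≢i | dec-false (x ≟ j) x≢j = refl

permuteCopies : (Fin n → Permutation′ k) → (Fin n × Fin m → Fin k) → Fin n × Fin m → Fin k
permuteCopies π d (i , a) = π i ⟨$⟩ʳ d (i , a)

-- A permutation keeps distinct colours of one copy distinct, so only the links have to be
-- rechecked.
permuteCopies-proper : (d : Fin (2 + l) × Fin (2 + m) → Fin k)
  (π : Fin (2 + l) → Permutation′ k) →
  Proper (K⁻ (2 + l) (2 + m)) d →
  (∀ i → π (prev i) ⟨$⟩ʳ d (prev i , 1F) ≢ π i ⟨$⟩ʳ d (i , 0F)) →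
  Proper (K⁻ (2 + l) (2 + m)) (permuteCopies π d)
permuteCopies-proper d π d-proper = K⁻-proper (permuteCopies π d)
  λ i a b a≢b → d-proper (adj-inner i a≢b) ∘ ⟨$⟩ʳ-injective (π i)

missing-≢ : (b : Subset m) {x y : Fin m} → lookup b x ≡ true → lookup b y ≡ false → x ≢ y
missing-≢ b x∈b y∉b refl with () ← trans (sym x∈b) y∉b

-- In a proper colouring with `m − 1` colours, the ends and `w` are the only positions of the copy
-- with the colour of an end or of `w`. Without clues there, exchanging these two colours
-- contradicts no clue.
Free : Subset (2 + m) → Set
Free b = lookup b 0F ≡ false × lookup b 1F ≡ false × ∃[ w ] lookup b (suc (suc w)) ≡ false

module _ (B : Vec (Subset (3 + q)) (2 + l))
  {d : Fin (2 + l) × Fin (3 + q) → Fin (2 + q)}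
  (d-proper : Proper (K⁻ (2 + l) (3 + q)) d) (determines : Determines B d) where

  -- Each of the two inner vertices is adjacent to the rest of the copy, so exchanging their colours
  -- moves no other position; in particular the ends, and with them the links, are untouched.
  missing-inner-unique : ∀ i (x y : Fin (suc q)) →
    lookup (lookup B i) (suc (suc x)) ≡ false →
    lookup (lookup B i) (suc (suc y)) ≡ false → x ≡ y
  missing-inner-unique i x y x∉B y∉B with x ≟ y
  ... | yes x≡y = x≡y
  ... | no  x≢y = contradiction
    (trans (determines (permuteCopies π d) (permuteCopies-proper d π d-proper linked) agree (i , X))
           moved)
    (d-proper (adj-inner i (x≢y ∘ suc-injective ∘ suc-injective)))
    where
    X Y : Fin (3 + q)
    X = suc (suc x)
    Y = suc (suc y)
    π : Fin (2 + l) → Permutation′ (2 + q)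
    π j with j ≟ i
    ... | yes _ = P.transpose (d (i , X)) (d (i , Y))
    ... | no  _ = P.id
    moved : π i ⟨$⟩ʳ d (i , X) ≡ d (i , Y)
    moved with i ≟ i
    ... | yes _   = transpose-left (d (i , X)) (d (i , Y))
    ... | no  i≢i = contradiction refl i≢i
    fixed : ∀ j a → (j ≡ i → a ≢ X × a ≢ Y) → π j ⟨$⟩ʳ d (j , a) ≡ d (j , a)
    fixed j a away with j ≟ i
    ... | no  _    = refl
    ... | yes refl = transpose-fixes (d-proper (adj-inner i (proj₁ (away refl))))
                                     (d-proper (adj-inner i (proj₂ (away refl))))
    linked : ∀ j → π (prev j) ⟨$⟩ʳ d (prev j , 1F) ≢ π j ⟨$⟩ʳ d (j , 0F)
    linked j rewrite fixed (prev j) 1F (λ _ → (λ ()) , (λ ()))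
                   | fixed j 0F (λ _ → (λ ()) , (λ ())) = d-proper (adj-link j)
    agree : Agree B d (permuteCopies π d)
    agree j a a∈B = sym (fixed j a λ { refl →
      missing-≢ (lookup B i) a∈B x∉B , missing-≢ (lookup B i) a∈B y∉B })

  -- A switching set `F` for the cycle lifts to the graph by transposing `t j` and `s j` in the
  -- copies with `F j` true; the ends then carry `select F t s`, and those of the switched copy `i`
  -- really change.
  some-copy-not-free : ¬ (∀ i → Free (lookup B i))
  some-copy-not-free free = contradiction
    (trans (determines (permuteCopies π d) (permuteCopies-proper d π d-proper linked) agree (i , 0F))
           moved)
    (t≢s i)
    where
    W : Fin (2 + l) → Fin (3 + q)
    W i = suc (suc (proj₁ (proj₂ (proj₂ (free i)))))
    t s : Fin (2 + l) → Fin (2 + q)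
    t i = d (i , 0F)
    s i = d (i , W i)
    t-proper : ProperCycle t
    t-proper i e = d-proper (adj-link i) (trans (sym (ends-alike d d-proper (prev i))) e)
    t≢s : ∀ i → t i ≢ s i
    t≢s i = d-proper (adj-inner i λ ())
    switchable : Switchable t s
    switchable = cycle-not-uniquely-2-list-colourable t s t-proper t≢s
    F : Fin (2 + l) → Bool
    F = proj₁ switchable
    i : Fin (2 + l)
    i = proj₁ (proj₁ (proj₂ switchable))
    π : Fin (2 + l) → Permutation′ (2 + q)
    π j = if F j then P.transpose (t j) (s j) else P.id
    π-end : ∀ j → π j ⟨$⟩ʳ t j ≡ select F t s j
    π-end j with F j
    ... | true  = transpose-left (t j) (s j)
    ... | false = refl
    moved : π i ⟨$⟩ʳ t i ≡ s i
    moved rewrite π-end i | proj₂ (proj₁ (proj₂ switchable)) = refl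
    linked : ∀ j → π (prev j) ⟨$⟩ʳ d (prev j , 1F) ≢ π j ⟨$⟩ʳ d (j , 0F)
    linked j rewrite sym (ends-alike d d-proper (prev j)) | π-end (prev j) | π-end j =
      proj₂ (proj₂ switchable) j
    agree : Agree B d (permuteCopies π d)
    agree j a a∈B with F j | free j
    ... | false | _ = refl
    ... | true  | 0∉B , 1∉B , _ , w∉B =
      sym (transpose-fixes (≢ends a (missing-≢ (lookup B j) a∈B 0∉B) (missing-≢ (lookup B j) a∈B 1∉B))
                           (d-proper (adj-inner j (missing-≢ (lookup B j) a∈B w∉B))))
      where
      ≢ends : ∀ a → a ≢ 0F → a ≢ 1F → d (j , a) ≢ t j
      ≢ends 0F a≢0 _ = contradiction refl a≢0
      ≢ends 1F _ a≢1 = contradiction refl a≢1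
      ≢ends (suc (suc a)) _ _ = d-proper (adj-inner j λ ()) ∘ sym

-- Counting clues and the lower bound.

∣++∣ : (p : Subset m) (r : Subset n) → ∣ p ++ r ∣ ≡ ∣ p ∣ + ∣ r ∣
∣++∣ []          r = refl
∣++∣ (true  ∷ p) r = cong suc (∣++∣ p r)
∣++∣ (false ∷ p) r = ∣++∣ p r

concat-size : (B : Vec (Subset m) n) → (∀ i → q ≤ ∣ lookup B i ∣) → n * q ≤ ∣ concat B ∣
concat-size []      q≤ = z≤n
concat-size (b ∷ B) q≤ rewrite ∣++∣ b (concat B) =
  ℕ.+-mono-≤ (q≤ zero) (concat-size B (q≤ ∘ suc))

concat-size-strict : (B : Vec (Subset m) n) → (∀ i → q ≤ ∣ lookup B i ∣) →
  ∀ i → suc q ≤ ∣ lookup B i ∣ → suc (n * q) ≤ ∣ concat B ∣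
concat-size-strict (b ∷ B) q≤ zero q< rewrite ∣++∣ b (concat B) =
  ℕ.+-mono-≤ q< (concat-size B (q≤ ∘ suc))
concat-size-strict {n = suc n} {q} (b ∷ B) q≤ (suc i) q<
  rewrite ∣++∣ b (concat B) | sym (ℕ.+-suc q (n * q)) =
  ℕ.+-mono-≤ (q≤ zero) (concat-size-strict B (q≤ ∘ suc) i q<)

concat-replicate-size : ∀ n (b : Subset m) → ∣ concat (replicate n b) ∣ ≡ n * ∣ b ∣
concat-replicate-size zero    b = refl
concat-replicate-size (suc n) b =
  trans (∣++∣ b (concat (replicate n b))) (cong (∣ b ∣ +_) (concat-replicate-size n b))

-- The missing position is returned along with the count because `Free` asks for an inner vertex
-- without clue.
full-or-one-missing : (p : Subset m) →
  (∀ x y → lookup p x ≡ false → lookup p y ≡ false → x ≡ y) →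
  m ≤ ∣ p ∣ ⊎ (m ≤ suc ∣ p ∣ × ∃[ x ] lookup p x ≡ false)
full-or-one-missing []      unique = inj₁ z≤n
full-or-one-missing (true ∷ p) unique
  with full-or-one-missing p (λ x y x∉p y∉p → suc-injective (unique (suc x) (suc y) x∉p y∉p))
... | inj₁ m≤             = inj₁ (s≤s m≤)
... | inj₂ (m≤ , x , x∉p) = inj₂ (s≤s m≤ , suc x , x∉p)
full-or-one-missing (false ∷ p) unique
  with full-or-one-missing p (λ x y x∉p y∉p → suc-injective (unique (suc x) (suc y) x∉p y∉p))
... | inj₁ m≤ = inj₂ (s≤s m≤ , zero , refl)
... | inj₂ (_ , x , x∉p) with () ← unique zero (suc x) refl x∉p

-- The `suc q` inner positions contribute at least `q` clues. A marked end, or no missing inner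
-- position, improves this by one; otherwise the copy is free.
large-or-free : (b : Subset (3 + q)) →
  (∀ x y → lookup b (suc (suc x)) ≡ false → lookup b (suc (suc y)) ≡ false → x ≡ y) →
  suc q ≤ ∣ b ∣ ⊎ (q ≤ ∣ b ∣ × Free b)
large-or-free (b₀ ∷ b₁ ∷ p) unique with b₀ | b₁ | full-or-one-missing p unique
... | true  | true  | inj₁ q<       = inj₁ (ℕ.m≤n⇒m≤1+n (ℕ.m≤n⇒m≤1+n q<))
... | true  | false | inj₁ q<       = inj₁ (ℕ.m≤n⇒m≤1+n q<)
... | false | true  | inj₁ q<       = inj₁ (ℕ.m≤n⇒m≤1+n q<)
... | false | false | inj₁ q<       = inj₁ q<
... | true  | true  | inj₂ (q≤ , _) = inj₁ (ℕ.m≤n⇒m≤1+n q≤)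
... | true  | false | inj₂ (q≤ , _) = inj₁ q≤
... | false | true  | inj₂ (q≤ , _) = inj₁ q≤
... | false | false | inj₂ (s≤s q≤ , missing) = inj₂ (q≤ , refl , refl , missing)

sudoku-size : ∀ {S} → AdmitsSudokuColoring (C₂ₙ⟨K⁻⟩ (2 + l) (3 + q)) (2 + q) S →
  q * (2 + l) + 1 ≤ ∣ S ∣
sudoku-size {l} {q} sudoku with sudoku⇒determines sudoku
... | B , refl , d , d-proper , determines
  rewrite ℕ.+-comm (q * (2 + l)) 1 | ℕ.*-comm q (2 + l)
  with any? (λ i → suc q ≤? ∣ lookup B i ∣)
... | yes (i , q<) = concat-size-strict B size i q<
  where
  size : ∀ i → q ≤ ∣ lookup B i ∣
  size i with large-or-free (lookup B i) (missing-inner-unique B d-proper determines i)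
  ... | inj₁ q<       = ℕ.<⇒≤ q<
  ... | inj₂ (q≤ , _) = q≤
... | no none-large = contradiction free (some-copy-not-free B d-proper determines)
  where
  free : ∀ i → Free (lookup B i)
  free i with large-or-free (lookup B i) (missing-inner-unique B d-proper determines i)
  ... | inj₁ q<         = contradiction (i , q<) none-large
  ... | inj₂ (_ , free) = free

-- A colouring and a clue set attaining the bound.

parity : ℕ → Fin (3 + m)
parity 0             = 0F
parity 1             = 1F
parity (suc (suc x)) = parity x

parity-alternates : ∀ x → parity {m} x ≢ parity (suc x)
parity-alternates (suc (suc x)) = parity-alternates x
parity-alternates 0 ()
parity-alternates 1 ()

parity≢2 : ∀ x → parity {m} x ≢ 2F
parity≢2 (suc (suc x)) = parity≢2 x
parity≢2 0 ()
parity≢2 1 ()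

-- Colours 0 and 1 alternate and the last vertex gets 2, so the seam is proper for even and odd
-- length alike.
cycleColour : Fin (suc l) → Fin (3 + m)
cycleColour i with view i
... | ‵fromℕ     = 2F
... | ‵inject₁ j = parity (toℕ j)

cycleColour-proper : ProperCycle (cycleColour {suc l} {m})
cycleColour-proper {l} zero rewrite view-fromℕ l = λ ()
cycleColour-proper (suc i) rewrite view-inject₁ i with view i
... | ‵fromℕ     = parity≢2 (toℕ i)
... | ‵inject₁ j rewrite toℕ-inject₁ j = parity-alternates (toℕ j)

-- The transposition applied last sends 0 to `x`. The one applied first sends 1 to the preimage `y′`
-- of `y` and fixes 0, as `y′` is not 0.
two-point-permutation : {x y : Fin (2 + m)} → x ≢ y →
  ∃[ π ] π ⟨$⟩ʳ 0F ≡ x × π ⟨$⟩ʳ 1F ≡ y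
two-point-permutation {x = x} {y} x≢y = P.transpose 1F y′ ∘ₚ P.transpose 0F x , at-0 , at-1
  where
  y′ : Fin _
  y′ = transpose x 0F y
  y′-inverse : transpose 0F x y′ ≡ y
  y′-inverse = transpose-inverse 0F x
  0≢y′ : 0F ≢ y′
  0≢y′ e = x≢y (trans (sym (transpose-left 0F x)) (trans (cong (transpose 0F x) e) y′-inverse))
  at-0 : transpose 0F x (transpose 1F y′ 0F) ≡ x
  at-0 = trans (cong (transpose 0F x) (transpose-fixes {i = 1F} (λ ()) 0≢y′)) (transpose-left 0F x)
  at-1 : transpose 0F x (transpose 1F y′ 1F) ≡ y
  at-1 = trans (cong (transpose 0F x) (transpose-left 1F y′)) y′-inverse

-- Colour pattern of a copy before permuting: 0 at both ends and 1, 2, ... at the inner vertices.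
-- Later `π i` sends 0 to `t i`, and 1, the colour at `2F`, to `s i`.
mergeEnds : Fin (2 + m) → Fin (suc m)
mergeEnds zero    = zero
mergeEnds (suc a) = a

module Witness (l p : ℕ) where

  t s : Fin (2 + l) → Fin (3 + p)
  t = cycleColour
  s = t ∘ prev

  permutation : ∀ i → ∃[ π ] π ⟨$⟩ʳ 0F ≡ t i × π ⟨$⟩ʳ 1F ≡ s i
  permutation i = two-point-permutation (cycleColour-proper i ∘ sym)

  π : Fin (2 + l) → Permutation′ (3 + p)
  π = proj₁ ∘ permutation

  π-0 : ∀ i → π i ⟨$⟩ʳ 0F ≡ t i
  π-0 = proj₁ ∘ proj₂ ∘ permutation

  π-1 : ∀ i → π i ⟨$⟩ʳ 1F ≡ s i
  π-1 = proj₂ ∘ proj₂ ∘ permutation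

  colouring : Fin (2 + l) × Fin (4 + p) → Fin (3 + p)
  colouring (i , a) = π i ⟨$⟩ʳ mergeEnds a

  colouring-proper : Proper (K⁻ (2 + l) (4 + p)) colouring
  colouring-proper = K⁻-proper colouring inner linked
    where
    mergeEnds≢ : ∀ a b → a ≢ suc (suc b) → mergeEnds a ≢ suc b
    mergeEnds≢ (suc a) b a≢b = a≢b ∘ cong suc
    inner : ∀ i a b → a ≢ suc (suc b) → colouring (i , a) ≢ colouring (i , suc (suc b))
    inner i a b a≢b = mergeEnds≢ a b a≢b ∘ ⟨$⟩ʳ-injective (π i)
    linked : ∀ i → colouring (prev i , 1F) ≢ colouring (i , 0F)
    linked i rewrite π-0 (prev i) | π-0 i = cycleColour-proper i

  -- The inner vertex left without clue is `2F`; `b` decides about the end `0F`, which is a clue in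
  -- copy `zero` alone.
  copyClues : Bool → Subset (4 + p)
  copyClues b = b ∷ false ∷ false ∷ ⊤

  clues : Vec (Subset (4 + p)) (2 + l)
  clues = copyClues true ∷ replicate (suc l) (copyClues false)

  clues-inner : ∀ i j → lookup (lookup clues i) (suc (suc (suc j))) ≡ true
  clues-inner zero    j = lookup-replicate j true
  clues-inner (suc i) j rewrite lookup-replicate i (copyClues false) = lookup-replicate j true

  clues-size : ∣ concat clues ∣ ≡ suc p * (2 + l) + 1
  clues-size = begin
    ∣ concat clues ∣
      ≡⟨ ∣++∣ (copyClues true) (concat (replicate (suc l) (copyClues false))) ⟩
    ∣ copyClues true ∣ + ∣ concat (replicate (suc l) (copyClues false)) ∣
      ≡⟨ cong (∣ copyClues true ∣ +_) (concat-replicate-size (suc l) (copyClues false)) ⟩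
    suc ((2 + l) * ∣ ⊤ {suc p} ∣)
      ≡⟨ cong (λ z → suc ((2 + l) * z)) (∣⊤∣≡n (suc p)) ⟩
    1 + (2 + l) * suc p
      ≡⟨ cong suc (ℕ.*-comm (2 + l) (suc p)) ⟩
    1 + suc p * (2 + l)
      ≡⟨ ℕ.+-comm 1 _ ⟩
    suc p * (2 + l) + 1 ∎
    where open ≡-Reasoning

  clues-determine : Determines clues colouring
  clues-determine d d-proper agree = uncurry λ i a → sym (same i a)
    where
    -- Every colour other than `t i` and `s i` is already the clue of an inner vertex from position
    -- 3 on, adjacent to `a`.
    two-options : ∀ i a → (∀ j → a ≢ suc (suc (suc j))) → d (i , a) ≡ t i ⊎ d (i , a) ≡ s i
    two-options i a not-clue with π i ⟨$⟩ˡ d (i , a) in eq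
    ... | e with trans (cong (π i ⟨$⟩ʳ_) (sym eq)) (inverseʳ (π i) {d (i , a)})
    two-options i a not-clue | 0F | πe = inj₁ (trans (sym πe) (π-0 i))
    two-options i a not-clue | 1F | πe = inj₂ (trans (sym πe) (π-1 i))
    two-options i a not-clue | suc (suc j) | πe = contradiction
      (trans (sym πe) (agree i (suc (suc (suc j))) (clues-inner i j)))
      (d-proper (adj-inner i (not-clue j)))

    start : ∀ i → d (i , 0F) ≡ t i
    start = <-weakInduction _ (trans (sym (agree zero 0F refl)) (π-0 zero)) step
      where
      step : ∀ i → d (inject₁ i , 0F) ≡ t (inject₁ i) → d (suc i , 0F) ≡ t (suc i)
      step i ih with two-options (suc i) 0F (λ _ ())
      ... | inj₁ d≡t = d≡t
      -- By definition `s (suc i)` is `t (inject₁ i)`, the colour already forced on the linked end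
      -- of the previous copy.
      ... | inj₂ d≡s = contradiction
        (trans (sym (ends-alike d d-proper (inject₁ i))) (trans ih (sym d≡s)))
        (d-proper (adj-link (suc i)))

    same : ∀ i a → d (i , a) ≡ colouring (i , a)
    same i 0F = trans (start i) (sym (π-0 i))
    same i 1F = trans (sym (ends-alike d d-proper i)) (same i 0F)
    same i 2F with two-options i 2F (λ _ ())
    ... | inj₁ d≡t = contradiction (trans (start i) (sym d≡t)) (d-proper (adj-inner i λ ()))
    ... | inj₂ d≡s = trans d≡s (sym (π-1 i))
    same i (suc (suc (suc j))) = sym (agree i (suc (suc (suc j))) (clues-inner i j))

-- Chromatic number and connectedness.

clique-bound : ∀ j → Colorable (C₂ₙ⟨K⁻⟩ (suc n) (2 + m)) j → suc m ≤ j
clique-bound {n} {m} j (c , c-proper) = injective⇒≤ {f = colour} colour-injective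
  where
  d : Fin (suc n) × Fin (2 + m) → Fin j
  d = c ∘ uncurry combine
  d-proper : Proper (K⁻ (suc n) (2 + m)) d
  d-proper = proper-on-pairs (λ {u} {v} → c-proper {u} {v})
  -- Leaving out the end `1F` turns copy `zero` into a clique on `suc m` vertices.
  colour : Fin (suc m) → Fin j
  colour a = d (zero , punchIn 1F a)
  to-inner : ∀ a b → colour a ≡ colour (suc b) → a ≡ suc b
  to-inner a b eq with a ≟ suc b
  ... | yes a≡b = a≡b
  ... | no  a≢b = contradiction eq (d-proper (adj-inner zero (a≢b ∘ punchIn-injective 1F a (suc b))))
  colour-injective : ∀ {a b} → colour a ≡ colour b → a ≡ b
  colour-injective {zero}  {zero}  _  = refl
  colour-injective {a}     {suc b} eq = to-inner a b eq
  colour-injective {suc a} {zero}  eq = sym (to-inner zero a (sym eq))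

-- The inner vertex `2F` is adjacent to its whole copy, and consecutive such hubs are joined through
-- the link between their copies.
K⁻-connected : Connected (K⁻ (2 + l) (3 + m))
K⁻-connected {l} {m} (i , a) (j , b) =
  to-hub i a ◅◅ reverse (symm G) (between-hubs i) ◅◅
  between-hubs j ◅◅ reverse (symm G) (to-hub j b)
  where
  G : Graph (Fin (2 + l) × Fin (3 + m))
  G = K⁻ (2 + l) (3 + m)
  to-hub : ∀ i a → Star (Adj G) (i , a) (i , 2F)
  to-hub i a with a ≟ 2F
  ... | yes refl = ε
  ... | no  a≢2  = adj-inner i a≢2 ◅ ε
  between-hubs : ∀ i → Star (Adj G) (zero , 2F) (i , 2F)
  between-hubs = <-weakInduction _ ε λ i path →
    path ◅◅ symm G {inject₁ i , 1F} (adj-inner (inject₁ i) λ ()) ◅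
    adj-link (suc i) ◅ to-hub (suc i) 0F

connected-on-pairs : Connected (K⁻ n m) → Connected (C₂ₙ⟨K⁻⟩ n m)
connected-on-pairs {n} {m} connected u v =
  subst₂ (Star _) (combine-remQuot {n} m u) (combine-remQuot {n} m v)
    (gmap (uncurry combine) adj-combine (connected (remQuot m u) (remQuot m v)))

theorem3p11 : (n m : ℕ) → 2 ≤ n → 4 ≤ m →
    HasSudokuNumber (C₂ₙ⟨K⁻⟩ n m) ((m ∸ 3) * n + 1)
theorem3p11 (suc (suc l)) (suc (suc (suc (suc p)))) (s≤s (s≤s z≤n)) (s≤s (s≤s (s≤s (s≤s z≤n)))) =
  record
  { connected = connected-on-pairs K⁻-connected
  -- One colour fewer than the `4 + p` vertices of a copy, since its ends share a colour.
  ; k         = 3 + p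
  ; chromatic = (colouring ∘ remQuot (4 + p) , colouring-proper) , clique-bound
  ; k≥2       = s≤s (s≤s z≤n)
  ; attained  = concat clues ,
                determines⇒sudoku clues colouring colouring-proper clues-determine , clues-size
  ; minimal   = λ _ → sudoku-size
  }
  where open Witness l p
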